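{- Let $P$ be a finite poset and let $M$ be a monoid (under function composition) consisting of regressive, order-preserving functions $P\to P$. If there are $f,g\in M$ and $x,y\in P$ such that $f(x)\not\leq g(x)$ and $f(y)\not\geq g(y)$, then $X(M)$ is not linear.
   Context: A function $f:P\to P$ on a poset is regressive if $f(p)\leq p$ for all $p\in P$, and order-preserving if $x\leq y$ implies $f(x)\leq f(y)$. The identity of $M$ is the identity function and the product is $(fg)(p)=f(g(p))$. For a monoid $M$ and $m\in M$, put $mM=\{mx : x\in M\}$. $X(M)=\{mM : m\in M\}$ is viewed as a poset ordered by inclusion; it is linear if any two of its elements are comparable under $\subseteq$. -}

module Defs where

open import Algebra.Bundles using (Monoid)
open import Data.Fin.Base using (Fin)
open import Data.Product.Base using (Σ-syntax; ∃-syntax; _,_; proj₁; proj₂)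
open import Function.Bundles using (Func; Inverse; _⟶ₛ_; _⟨$⟩_)
open import Function.Construct.Composition using (function)
import Function.Construct.Identity as Identity
open import Function.Relation.Binary.Setoid.Equality using (_⇨_)
open import Level using (Level; _⊔_; suc)
open import Relation.Binary.Bundles using (Setoid; Poset)
import Relation.Binary.Construct.On as On
open import Relation.Binary.Core using (_Preserves_⟶_)
open import Relation.Binary.Definitions using (Total; _Respects_)
import Relation.Binary.PropositionalEquality.Properties as ≡
open import Relation.Unary using (Pred; _≐_; _∈_)
open import Relation.Unary.Relation.Binary.Subset using (⊆-poset)

private
  variable
    c ℓ ℓ₁ ℓ₂ : Level

Finite : Setoid c ℓ → Set (c ⊔ ℓ)
Finite S = ∃[ n ] Inverse (≡.setoid (Fin n)) S

module _ (P : Poset c ℓ₁ ℓ₂) where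

  open Poset P

  Regressive : Pred (Eq.setoid ⟶ₛ Eq.setoid) (c ⊔ ℓ₂)
  Regressive f = ∀ p → f ⟨$⟩ p ≤ p

  OrderPreserving : Pred (Eq.setoid ⟶ₛ Eq.setoid) (c ⊔ ℓ₂)
  OrderPreserving f = (f ⟨$⟩_) Preserves _≤_ ⟶ _≤_

Linear : Poset c ℓ₁ ℓ₂ → Set (c ⊔ ℓ₂)
Linear P = Total (Poset._≤_ P)

infixr 9 _∘ₛ_

-- (f ∘ₛ g) p = f (g p). The library's `function`, and with it the product of
-- Function.Endo.Setoid.∘-id-monoid, takes its arguments in the opposite order.
_∘ₛ_ : {S : Setoid c ℓ} → S ⟶ₛ S → S ⟶ₛ S → S ⟶ₛ S
f ∘ₛ g = function g f

-- A set of functions S → S that is a monoid under composition, with the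
-- identity function as its identity. Functions are equal when they agree
-- pointwise, and a set of functions has to respect that equality.
record FunctionMonoid (S : Setoid c ℓ) (u : Level) : Set (c ⊔ ℓ ⊔ suc u) where
  field
    Member   : Pred (S ⟶ₛ S) u
    respects : Member Respects (Setoid._≈_ (S ⇨ S))
    id-mem   : Identity.function S ∈ Member
    ∘-mem    : ∀ {f g} → f ∈ Member → g ∈ Member → (f ∘ₛ g) ∈ Member

  private
    module S = Setoid S

  monoid : Monoid (c ⊔ ℓ ⊔ u) (c ⊔ ℓ)
  monoid = record
    { Carrier  = Σ[ f ∈ S ⟶ₛ S ] f ∈ Member
    ; _≈_      = λ f g → Setoid._≈_ (S ⇨ S) (proj₁ f) (proj₁ g)
    ; _∙_      = λ f g → (proj₁ f ∘ₛ proj₁ g) , ∘-mem (proj₂ f) (proj₂ g)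
    ; ε        = Identity.function S , id-mem
    ; isMonoid = record
      { isSemigroup = record
        { isMagma = record
          { isEquivalence = On.isEquivalence proj₁ (Setoid.isEquivalence (S ⇨ S))
          ; ∙-cong = λ {f} {f′} {g} {g′} f≈f′ g≈g′ p →
              S.trans (Func.cong (proj₁ f) (g≈g′ p)) (f≈f′ (proj₁ g′ ⟨$⟩ p))
          }
        ; assoc = λ _ _ _ _ → S.refl
        }
      ; identity = (λ _ _ → S.refl) , (λ _ _ → S.refl)
      }
    }

module _ (M : Monoid c ℓ) where

  open Monoid M

  principalRightIdeal : Carrier → Pred Carrier (c ⊔ ℓ)
  principalRightIdeal m y = ∃[ x ] y ≈ m ∙ x

  -- { mM : m ∈ M } as a sub-poset of the subsets of M ordered by inclusion;
  -- equality of its elements is extensional equality _≐_ of subsets.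
  X : Poset (suc (c ⊔ ℓ)) (c ⊔ ℓ) (c ⊔ ℓ)
  X = On.poset (⊆-poset Carrier (c ⊔ ℓ)) toSubset
    where
    toSubset : (Σ[ A ∈ Pred Carrier (c ⊔ ℓ) ] ∃[ m ] A ≐ principalRightIdeal m) →
               Pred Carrier (c ⊔ ℓ)
    toSubset = proj₁

{-# OPTIONS --safe #-}
module Submission where

open import Defs
open import Algebra.Bundles using (Monoid)
open import Data.Product.Base using (_×_; _,_; proj₁; proj₂)
open import Data.Sum.Base using (inj₁; inj₂)
open import Function.Base using (id)
open import Function.Bundles using (_⟶ₛ_; _⟨$⟩_)
open import Relation.Binary.Bundles using (Poset)
open import Relation.Nullary using (¬_)
open import Relation.Unary using (_∈_; _⊆_)

-- Inclusion of principal right ideals forces pointwise comparison of their generators: if fM ⊆ gM,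
-- then f = gh for some h in M, and f(p) = g(h(p)) ≤ g(p). Linearity of X(M) would thus make f and g
-- pointwise comparable, but `x` excludes one direction and `y` the other.

module _ {c ℓ} (M : Monoid c ℓ) where

  open Monoid M

  ∈-principalRightIdeal : ∀ m → m ∈ principalRightIdeal M m
  ∈-principalRightIdeal m = ε , sym (identityʳ m)

  -- Taking the subset to be the ideal itself makes the order of `X` between two such elements the
  -- plain inclusion of ideals.
  principal : Carrier → Poset.Carrier (X M)
  principal m = principalRightIdeal M m , m , id , id

module _ {c ℓ₁ ℓ₂ u} (P : Poset c ℓ₁ ℓ₂) (M : FunctionMonoid (Poset.Eq.setoid P) u) where

  open Poset P
  open FunctionMonoid M

  ideal-⊆⇒≤ :
    (∀ h → h ∈ Member → Regressive P h × OrderPreserving P h) →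
    ∀ (f g : Monoid.Carrier monoid) →
    principalRightIdeal monoid f ⊆ principalRightIdeal monoid g →
    ∀ p → proj₁ f ⟨$⟩ p ≤ proj₁ g ⟨$⟩ p
  ideal-⊆⇒≤ regOp f (g , g∈M) fM⊆gM p with fM⊆gM {f} (∈-principalRightIdeal monoid f)
  ... | (h , h∈M) , f≈gh =
    -- Regressivity is applied to the cofactor `h`, giving h(p) ≤ p; monotonicity of `g` carries
    -- this to g(h(p)) ≤ g(p).
    trans (reflexive (f≈gh p)) (proj₂ (regOp g g∈M) (proj₁ (regOp h h∈M) p))

lemma3p2 : ∀ {c ℓ₁ ℓ₂ u} (P : Poset c ℓ₁ ℓ₂) → let open Poset P in
    Finite Eq.setoid →
    (M : FunctionMonoid Eq.setoid u) → let open FunctionMonoid M in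
    (∀ h → h ∈ Member → Regressive P h × OrderPreserving P h) →
    ∀ (f g : Eq.setoid ⟶ₛ Eq.setoid) → f ∈ Member → g ∈ Member →
    ∀ (x y : Carrier) →
    ¬ (f ⟨$⟩ x ≤ g ⟨$⟩ x) →
    ¬ (f ⟨$⟩ y ≥ g ⟨$⟩ y) →
    ¬ Linear (X monoid)
lemma3p2 P _ M regOp f g f∈M g∈M x y fx≰gx fy≱gy linear
  with linear (principal (FunctionMonoid.monoid M) (f , f∈M)) (principal (FunctionMonoid.monoid M) (g , g∈M))
... | inj₁ fM⊆gM = fx≰gx (ideal-⊆⇒≤ P M regOp (f , f∈M) (g , g∈M) (λ {h} → fM⊆gM {h}) x)
-- With the roles swapped the lemma yields g(y) ≤ f(y), which is what `fy≱gy` denies.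
... | inj₂ gM⊆fM = fy≱gy (ideal-⊆⇒≤ P M regOp (g , g∈M) (f , f∈M) (λ {h} → gM⊆fM {h}) y)
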